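{- Let $\Sigma$ be a finite set of size $k>3$ and let $n$ be a positive integer. Let $|Q(n,k)|$ be the number of $n$-quasigroups $\Sigma^n\to\Sigma$. Then: (a) if $k$ is even, $|Q(n,k)|\ge 2^{(k/2)^n}$; (b) if $k$ is divisible by $3$, $|Q(n,k)|\ge 2^{n(k/3)^n}$; (c) if $k=5$, $|Q(n,k)|\ge 2^{3^{n/3-c}}$, where $c<0.072$ is a constant depending only on $n\bmod 3$; (d) in all other cases (i.e., $k$ odd, not divisible by $3$, and $k\ne 5$), $|Q(n,k)|\ge 2^{1.5\lfloor k/3\rfloor^n}$.
   Context: For a nonempty set $\Sigma$ and a positive integer $n$, an $n$-ary operation $f:\Sigma^n\to\Sigma$ is an $n$-quasigroup if in the equality $z_0=f(z_1,\ldots,z_n)$ knowledge of any $n$ of the elements $z_0,\ldots,z_n$ uniquely specifies the remaining one. Distinct operations are counted as distinct. -}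

module Defs where

open import Data.Nat using (ℕ; _+_; _*_; _^_; _<_; _≤_)
open import Data.Fin using (Fin)
open import Data.Product using (Σ; ∃; ∃!; _×_)
open import Data.Vec.Functional using (updateAt)
open import Function using (const)
open import Relation.Binary.PropositionalEquality using (_≡_; _≢_)

-- The alphabet Σ of size k is taken to be Fin k (the number of
-- n-quasigroups depends only on |Σ|).

Op : ℕ → ℕ → Set
Op n k = (Fin n → Fin k) → Fin k

-- f is an n-quasigroup: in z₀ = f(z₁,…,zₙ), any n of the z's uniquely
-- determine the remaining one.  For the remaining one being z₀ this holds
-- because f is a function; for the remaining one being zⱼ (j : Fin n) it says:
-- for all values x of the other arguments and all z₀ there is a unique y with
-- f(x with j-th argument replaced by y) = z₀.
IsQuasigroup : {n k : ℕ} → Op n k → Set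
IsQuasigroup {n} {k} f =
  (j : Fin n) (x : Fin n → Fin k) (z₀ : Fin k) →
  ∃! _≡_ (λ y → f (updateAt x j (const y)) ≡ z₀)

AtLeast : ℕ → ℕ → ℕ → Set
AtLeast n k N =
  Σ (Fin N → Op n k) λ F →
    ((i : Fin N) → IsQuasigroup (F i)) ×
    ((i j : Fin N) → i ≢ j → ∃ λ x → F i x ≢ F j x)

-- |Q(n,5)| ≥ 2 ^ (3 ^ (n/3 - p/q))  (for q > 0), expressed without reals:
-- for every nonnegative rational a/b below the real exponent
-- x = 3^(n/3 - p/q), i.e. (a/b)^(3q) < 3^(nq - 3p), i.e.
-- a^(3q) * 3^(3p) < 3^(nq) * b^(3q), we have |Q(n,5)|^b ≥ 2^a.
-- By continuity of 2^· this is equivalent to |Q(n,5)| ≥ 2^x.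
AtLeast2^3^ : (n p q : ℕ) → Set
AtLeast2^3^ n p q =
  (a b : ℕ) → 0 < b →
  a ^ (3 * q) * 3 ^ (3 * p) < 3 ^ (n * q) * b ^ (3 * q) →
  ∃ λ N → AtLeast n 5 N × 2 ^ a ≤ N ^ b

{-# OPTIONS --safe #-}
module Submission where

-- If a set S of points is closed, along every line, under passing to the point whose value is the
-- mate of the present one under an involution of the alphabet, then replacing f by its mate on S
-- gives another quasigroup; N disjoint such sets (cells) give 2 ^ N quasigroups.  In a composition
-- f₁(x) ∙ f₂(y) a product of two cells is a cell as soon as the pairs of their values span an
-- intercalate of ∙.
-- (c) A square of order 5 with an intercalate on {0,1} yields 2 cells in two variables and 3 cells
-- in three, hence 3 ^ m, 4 · 3 ^ (m - 1) or 2 · 3 ^ m cells for n = 3 m, 3 m + 1, 3 m + 2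
-- (n > 1).
-- (d) For k = 2 q + 1, blowing up a square of order q around a transversal gives a square of order k
-- with q (q - 1) aligned intercalates, and its iteration has q (q - 1) ^ (n - 1) cells.
-- For (a) and (b) one lifts the cyclic n-ary quasigroup of order k/2 or k/3 and chooses an n-ary
-- quasigroup of order 2 or 3 independently over each of its points.

open import Defs
open import Data.Nat using (ℕ; zero; suc; z≤n; s≤s; s≤s⁻¹; z<s; s<s; NonZero; ∣_-_∣; _+_; _*_; _^_; _<_; _≤_; _/_; _%_)
open import Data.Nat.DivMod using (_mod_; m≡m%n+[m/n]*n; m%n<n; m%n%n≡m%n; m<n⇒m%n≡m; m*n/n≡m; m/n*n≤m; %-distribˡ-+)
open import Data.Nat.Divisibility using (_∣_; divides; ∣⇒≤; >⇒∤; ∣m+n∣m⇒∣n; ∣n⇒∣m*n; n∣m*n)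
import Data.Nat.Properties as ℕ
import Algebra.Properties.CommutativeSemigroup ℕ.*-commutativeSemigroup as *-Semigroup
open import Data.Fin using (Fin; zero; suc; toℕ; combine; finToFun; funToFin; join; splitAt; _↑ˡ_; _↑ʳ_; punchIn; punchOut)
open import Data.Fin.Patterns using (0F; 1F; 2F; 3F; 4F)
import Data.Fin.Properties as F
open import Data.Product using (Σ; ∃; ∃₂; _×_; _,_; proj₁; proj₂; map₂)
open import Data.Product.Function.NonDependent.Propositional using (_×-↔_)
open import Data.Product.Properties using (,-injectiveˡ; ,-injectiveʳ)
open import Relation.Nullary using (¬_; Dec; yes; no; contradiction)
open import Relation.Nullary.Decidable using (map′; from-yes; _×-dec_; _⊎-dec_; _→-dec_)
open import Relation.Unary using (Decidable)
open import Relation.Binary.PropositionalEquality using (_≡_; _≢_; _≗_; refl; sym; trans; cong; cong₂; subst; module ≡-Reasoning)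
open import Algebra.Core using (Op₂)
open import Algebra.Definitions using (Cancellative)
open import Data.Bool using (Bool; true; false; not; _xor_; if_then_else_)
import Data.Bool.Properties as B
open import Data.Maybe as Maybe using (Maybe; just; nothing)
open import Data.Maybe.Properties using (≡-dec)
open import Data.Sum using (_⊎_; inj₁; inj₂)
open import Data.Unit using (⊤; tt)
open import Data.Vec using (Vec; []; _∷_; _++_; _[_]≔_; foldr′; head; lookup; map; replicate; tabulate; take; drop; zip)
open import Data.Vec.Functional using (updateAt)
import Data.Vec.Properties as V
open import Function using (_∘_; const)
open import Function.Bundles using (Inverse; _↔_; mk↔ₛ′)
open import Function.Construct.Composition using (_↔-∘_)
open import Function.Construct.Identity using (↔-id)
open import Function.Construct.Symmetry using (↔-sym)
open import Function.Definitions using (Injective)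

open Inverse using (to; from; strictlyInverseˡ; strictlyInverseʳ)

-- Bijections between finite sets and codes of functions.

private
  to-injective : {A B : Set} (A↔B : A ↔ B) → Injective _≡_ _≡_ (to A↔B)
  to-injective A↔B {x} {y} eq =
    trans (sym (strictlyInverseʳ A↔B x)) (trans (cong (from A↔B) eq) (strictlyInverseʳ A↔B y))

  from-injective : {A B : Set} (A↔B : A ↔ B) → Injective _≡_ _≡_ (from A↔B)
  from-injective A↔B {x} {y} eq =
    trans (sym (strictlyInverseˡ A↔B x)) (trans (cong (to A↔B) eq) (strictlyInverseˡ A↔B y))

-- If `y` were missed, deleting it from the codomain would inject `Fin (suc n)` into `Fin n`.
injective⇒surjective : ∀ {n} {f : Fin n → Fin n} → Injective _≡_ _≡_ f → ∀ y → ∃ λ x → f x ≡ y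
injective⇒surjective {suc n} {f} f-injective y with F.any? (λ x → f x F.≟ y)
... | yes hit  = hit
... | no  miss = contradiction (F.injective⇒≤ omit-injective) ℕ.1+n≰n
  where
  y≢f : ∀ x → y ≢ f x
  y≢f x y≡fx = miss (x , sym y≡fx)

  omit-injective : Injective _≡_ _≡_ (λ x → punchOut (y≢f x))
  omit-injective {x} {x′} eq = f-injective (F.punchOut-injective (y≢f x) (y≢f x′) eq)

funToFin-cong : ∀ {m n} {f g : Fin m → Fin n} → f ≗ g → funToFin f ≡ funToFin g
funToFin-cong {zero}  f≗g = refl
funToFin-cong {suc m} f≗g = cong₂ combine (f≗g zero) (funToFin-cong (f≗g ∘ suc))

finToFun-separates : ∀ {m n} {i j : Fin (m ^ n)} → i ≢ j → ∃ λ d → finToFun i d ≢ finToFun j d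
finToFun-separates {m} {n} {i} {j} i≢j =
  F.¬∀⟶∃¬ n _ (λ d → finToFun i d F.≟ finToFun j d) λ i≗j → i≢j
    (trans (sym (F.funToFin-finToFin {n} {m} i)) (trans (funToFin-cong i≗j) (F.funToFin-finToFin {n} {m} j)))

tabulate-updateAt : ∀ {A B : Set} {n} (g : B → A) (x : Fin n → B) (j : Fin n) y →
                    tabulate (g ∘ updateAt x j (const y)) ≡ tabulate (g ∘ x) [ j ]≔ g y
tabulate-updateAt g x zero    y = refl
tabulate-updateAt g x (suc j) y = cong (g (x zero) ∷_) (tabulate-updateAt g (x ∘ suc) j y)

-- Families of quasigroups indexed by independent bits.

-- On a finite alphabet this makes f an n-quasigroup: injectivity along every line gives surjectivity.
Latin : {A : Set} {n : ℕ} → (Vec A n → A) → Set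
Latin f = ∀ v j {y z} → f (v [ j ]≔ y) ≡ f (v [ j ]≔ z) → y ≡ z

-- `C` is a set of sites carrying one free bit each. By `separate`, a change of any bit is visible
-- in the operation whatever the other bits are, so different choices give different operations.
record Family (A C : Set) (n : ℕ) : Set where
  field
    op       : (C → Bool) → Vec A n → A
    latin    : ∀ s → Latin (op s)
    separate : ∀ c s t → s c ≢ t c → ∃ λ v → op s v ≢ op t v

family⇒AtLeast : ∀ {A C k c n} → A ↔ Fin k → C ↔ Fin c → Family A C n → AtLeast n k (2 ^ c)
family⇒AtLeast {A} {C} {k} {c} {n} A↔k C↔c family = F , F-quasigroup , F-separate
  where
  open Family family

  select : Fin (2 ^ c) → C → Bool
  select i d = to F.2↔Bool (finToFun i (to C↔c d))

  F : Fin (2 ^ c) → Op n k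
  F i x = to A↔k (op (select i) (tabulate (from A↔k ∘ x)))

  F-injective : ∀ i j x → Injective _≡_ _≡_ (λ y → F i (updateAt x j (const y)))
  F-injective i j x {y} {z} eq = from-injective A↔k (latin (select i) (tabulate (from A↔k ∘ x)) j (begin
    op (select i) (tabulate (from A↔k ∘ x) [ j ]≔ from A↔k y)            ≡⟨ cong (op (select i)) (tabulate-updateAt _ x j y) ⟨
    op (select i) (tabulate (from A↔k ∘ updateAt x j (const y)))  ≡⟨ to-injective A↔k eq ⟩
    op (select i) (tabulate (from A↔k ∘ updateAt x j (const z)))  ≡⟨ cong (op (select i)) (tabulate-updateAt _ x j z) ⟩
    op (select i) (tabulate (from A↔k ∘ x) [ j ]≔ from A↔k z)            ∎))
    where open ≡-Reasoning

  F-quasigroup : ∀ i → IsQuasigroup (F i)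
  F-quasigroup i j x z₀ with injective⇒surjective (F-injective i j x) z₀
  ... | y , Fy≡z₀ = y , Fy≡z₀ , λ Fz≡z₀ → F-injective i j x (trans Fy≡z₀ (sym Fz≡z₀))

  F-separate : ∀ i j → i ≢ j → ∃ λ x → F i x ≢ F j x
  F-separate i j i≢j =
    let d , differ = finToFun-separates {2} {c} i≢j
        v , op≢ = separate (from C↔c d) (select i) (select j) λ eq → differ
          (subst (λ d → finToFun i d ≡ finToFun j d) (strictlyInverseˡ C↔c d) (to-injective F.2↔Bool eq))
        restore = trans (V.tabulate-cong λ i → strictlyInverseʳ A↔k (lookup v i)) (V.tabulate∘lookup v)
    in to A↔k ∘ lookup v , λ eq → op≢
         (subst (λ w → op (select i) w ≡ op (select j) w) restore (to-injective A↔k eq))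

-- Cancelling the letters before position `j` on the left, and then the product of those after it on
-- the right, isolates the letter at `j`.
foldr-latin : ∀ {A : Set} {_∙_ : Op₂ A} {e n} → Cancellative _≡_ _∙_ → Latin {n = n} (foldr′ _∙_ e)
foldr-latin (_ , cancelʳ) (x ∷ v) zero    eq = cancelʳ _ _ _ eq
foldr-latin cancel        (x ∷ v) (suc j) eq = foldr-latin cancel v j (proj₁ cancel x _ _ eq)

-- The quotient to B is fixed, and over each point of Bⁿ a member of the family is chosen independently.
wreath : ∀ {A B C n} (h : Vec B n → B) → Latin h → Family A C n → Family (B × A) (C × Vec B n) n
wreath {A} {B} {C} {n} h h-latin inner = record { op = op ; latin = latin ; separate = separate }
  where
  module I = Family inner

  op : (C × Vec B n → Bool) → Vec (B × A) n → B × A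
  op s v = h (map proj₁ v) , I.op (λ c → s (c , map proj₁ v)) (map proj₂ v)

  latin : ∀ s → Latin (op s)
  latin s v j {b , a} {b′ , a′} eq
    rewrite V.map-[]≔ {x = b , a} proj₁ v j | V.map-[]≔ {x = b′ , a′} proj₁ v j
          | V.map-[]≔ {x = b , a} proj₂ v j | V.map-[]≔ {x = b′ , a′} proj₂ v j
    -- The quotient coordinates are compared first: only once `b` and `b′` agree do both sides use
    -- the same member of the inner family.
    with refl ← h-latin _ j (,-injectiveˡ eq)
    with refl ← I.latin _ _ j (,-injectiveʳ eq) = refl

  separate : ∀ c s t → s c ≢ t c → ∃ λ v → op s v ≢ op t v
  separate (c , w) s t s≢t =
    let v , I≢ = I.separate c (λ c → s (c , w)) (λ c → t (c , w)) s≢t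
    -- `zip w v` lies over `w`, the point whose bits tell `s` and `t` apart.
    in zip w v , λ eq → I≢
         (subst (λ w′ → I.op (λ c → s (c , w′)) v ≡ I.op (λ c → t (c , w′)) v) (V.map-proj₁-zip w v)
           (subst (λ v′ → I.op (λ c → s (c , map proj₁ (zip w v))) v′ ≡ I.op (λ c → t (c , map proj₁ (zip w v))) v′)
             (V.map-proj₂-zip w v) (,-injectiveʳ eq)))

xor-cancellative : Cancellative _≡_ _xor_
xor-cancellative = cancelˡ , cancelʳ
  where
  cancelˡ : ∀ x y z → x xor y ≡ x xor z → y ≡ z
  cancelˡ false y     z     eq = eq
  cancelˡ true  false false eq = refl
  cancelˡ true  true  true  eq = refl

  cancelʳ : ∀ x y z → y xor x ≡ z xor x → y ≡ z
  cancelʳ x     false false eq = refl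
  cancelʳ x     true  true  eq = refl
  cancelʳ false false true  ()
  cancelʳ true  false true  ()
  cancelʳ false true  false ()
  cancelʳ true  true  false ()

-- The parity function and its complement, the two choices in order 2.
parityFamily : ∀ n → Family Bool ⊤ n
parityFamily n = record
  { op       = λ s v → s tt xor foldr′ _xor_ false v
  ; latin    = λ s v j eq → foldr-latin xor-cancellative v j (proj₁ xor-cancellative (s tt) _ _ eq)
  ; separate = λ { tt s t s≢t → replicate n false , λ eq → s≢t (proj₂ xor-cancellative _ _ _ eq) }
  }

-- Switching on cells and its behaviour under composition.

-- A cell is a set of points that is closed under exchanging u and φ u along every line;
-- P c contains the values taken on the cell c.
record Switching (A : Set) (φ : A → A) (n : ℕ) {C : Set} (P : C → A → Set) : Set where
  field
    op        : Vec A n → A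
    latin     : Latin op
    cell      : Vec A n → Maybe C
    inhabited : ∀ c → ∃ λ v → cell v ≡ just c
    value     : ∀ {v c} → cell v ≡ just c → P c (op v)
    closed    : ∀ {v c} → cell v ≡ just c → ∀ j →
                ∃ λ y → cell (v [ j ]≔ y) ≡ just c × op (v [ j ]≔ y) ≡ φ (op v)

module _ {A : Set} {φ : A → A} (φ-involutive : ∀ u → φ (φ u) ≡ u) where

  private
    φ-injective : Injective _≡_ _≡_ φ
    φ-injective {u} {u′} eq = trans (sym (φ-involutive u)) (trans (cong φ eq) (φ-involutive u′))

  -- `P` serves to show that `φ` moves all values on a cell, so switching the cell changes the
  -- operation at each of its points.
  switching⇒family : ∀ {n C} {P : C → A → Set} → (∀ {c u} → P c u → φ u ≢ u) →
                     Switching A φ n P → Family A C n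
  switching⇒family {n} {C} {P} moved S = record { op = opˢ ; latin = latinˢ ; separate = separateˢ }
    where
    open Switching S

    switch : Bool → A → A
    switch b u = if b then φ u else u

    choice : (C → Bool) → Maybe C → Bool
    choice s (just c) = s c
    choice s nothing  = false

    opˢ : (C → Bool) → Vec A n → A
    opˢ s v = switch (choice s (cell v)) (op v)

    switch-injective : ∀ b → Injective _≡_ _≡_ (switch b)
    switch-injective true  = φ-injective
    switch-injective false = λ eq → eq

    switch-orbit : ∀ b b′ {u u′} → switch b u ≡ switch b′ u′ → u ≡ u′ ⊎ u′ ≡ φ u
    switch-orbit true  true  eq   = inj₁ (φ-injective eq)
    switch-orbit true  false eq   = inj₂ (sym eq)
    switch-orbit false true  refl = inj₂ (sym (φ-involutive _))
    switch-orbit false false eq   = inj₁ eq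

    -- If only one of the two values were switched, then the other point would be
    -- the partner on this line of a point in a cell, hence itself in the cell.
    latin-from-cell : ∀ s v j {y z c} → cell (v [ j ]≔ y) ≡ just c →
                      opˢ s (v [ j ]≔ y) ≡ opˢ s (v [ j ]≔ z) → y ≡ z
    latin-from-cell s v j {y} {z} {c} y∈c eq
      with switch-orbit (choice s (cell (v [ j ]≔ y))) (choice s (cell (v [ j ]≔ z))) eq
    ... | inj₁ same = latin v j same
    ... | inj₂ swapped with closed y∈c j
    ...   | w , w∈c , op-w rewrite V.[]≔-idempotent {x = y} {y = w} v j
      with refl ← latin v j (trans swapped (sym op-w)) =
        latin v j (switch-injective (s c)
          (subst (λ m → switch (choice s m) (op (v [ j ]≔ y)) ≡ switch (s c) (op (v [ j ]≔ w))) y∈c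
            (subst (λ m → opˢ s (v [ j ]≔ y) ≡ switch (choice s m) (op (v [ j ]≔ w))) w∈c eq)))

    latinˢ : ∀ s → Latin (opˢ s)
    latinˢ s v j {y} {z} eq = by-cells (cell (v [ j ]≔ y)) refl (cell (v [ j ]≔ z)) refl
      where
      by-cells : ∀ m → cell (v [ j ]≔ y) ≡ m → ∀ m′ → cell (v [ j ]≔ z) ≡ m′ → y ≡ z
      by-cells (just c) y∈c m′       _   = latin-from-cell s v j y∈c eq
      by-cells nothing  y∉  (just c) z∈c = sym (latin-from-cell s v j z∈c (sym eq))
      by-cells nothing  y∉  nothing  z∉  = latin v j
        (subst (λ m → switch (choice s m) (op (v [ j ]≔ y)) ≡ op (v [ j ]≔ z)) y∉
          (subst (λ m → opˢ s (v [ j ]≔ y) ≡ switch (choice s m) (op (v [ j ]≔ z))) z∉ eq))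

    separateˢ : ∀ c s t → s c ≢ t c → ∃ λ v → opˢ s v ≢ opˢ t v
    separateˢ c s t s≢t with inhabited c
    ... | v , v∈c = v , differ
      where
      switch-faithful : ∀ b b′ → switch b (op v) ≡ switch b′ (op v) → b ≡ b′
      switch-faithful true  true  eq = refl
      switch-faithful false false eq = refl
      switch-faithful true  false eq = contradiction eq (moved (value v∈c))
      switch-faithful false true  eq = contradiction (sym eq) (moved (value v∈c))

      differ : opˢ s v ≢ opˢ t v
      differ eq = s≢t (subst (λ m → choice s m ≡ choice t m) v∈c (switch-faithful _ _ eq))

unary : ∀ {A φ C} {P : C → A → Set} (cell : A → Maybe C) → (∀ c → ∃ λ u → cell u ≡ just c) →
        (∀ {u c} → cell u ≡ just c → P c u) → (∀ {u c} → cell u ≡ just c → cell (φ u) ≡ just c) →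
        Switching A φ 1 P
unary {φ = φ} cell onto value closed = record
  { op        = head
  ; latin     = λ { (_ ∷ []) zero eq → eq }
  ; cell      = cell ∘ head
  ; inhabited = λ c → let u , u∈c = onto c in u ∷ [] , u∈c
  ; value     = value
  ; closed    = λ { {u ∷ []} u∈c zero → φ u , closed u∈c , refl }
  }

module _ {A : Set} {φ : A → A} {_∙_ : Op₂ A} (∙-cancellative : Cancellative _≡_ _∙_)
  {C₁ C₂ C : Set} {P₁ : C₁ → A → Set} {P₂ : C₂ → A → Set} {P : C → A → Set}
  (κ : C₁ → C₂ → Maybe C)
  (κ-onto : ∀ c → ∃₂ λ c₁ c₂ → κ c₁ c₂ ≡ just c)
  (κ-square : ∀ {c₁ c₂ c u w} → κ c₁ c₂ ≡ just c → P₁ c₁ u → P₂ c₂ w →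
              P c (u ∙ w) × φ u ∙ w ≡ φ (u ∙ w) × u ∙ φ w ≡ φ (u ∙ w))
  where

  -- `κ` selects and labels the products of cells that are kept, and `κ-square` is the intercalate
  -- condition: applying `φ` to either factor applies it to the product. A partner along a line in
  -- one block of variables is thus a partner for the whole operation.
  compose : ∀ {m n} → Switching A φ m P₁ → Switching A φ n P₂ → Switching A φ (m + n) P
  compose {m} {n} S₁ S₂ = record
    { op = op ; latin = latin ; cell = cell ; inhabited = inhabited ; value = value ; closed = closed }
    where
    module S₁ = Switching S₁
    module S₂ = Switching S₂

    κ? : Maybe C₁ → Maybe C₂ → Maybe C
    κ? (just c₁) (just c₂) = κ c₁ c₂
    κ? _         _         = nothing

    κ?-just : ∀ m₁ m₂ {c} → κ? m₁ m₂ ≡ just c → ∃₂ λ c₁ c₂ → m₁ ≡ just c₁ × m₂ ≡ just c₂ × κ c₁ c₂ ≡ just c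
    κ?-just (just c₁) (just c₂) eq = c₁ , c₂ , refl , refl , eq

    op : Vec A (m + n) → A
    op v = S₁.op (take m v) ∙ S₂.op (drop m v)

    cell : Vec A (m + n) → Maybe C
    cell v = κ? (S₁.cell (take m v)) (S₂.cell (drop m v))

    take-++ : (xs : Vec A m) (ys : Vec A n) → take m (xs ++ ys) ≡ xs
    take-++ xs ys = V.++-injectiveˡ _ xs (V.take++drop≡id m (xs ++ ys))

    drop-++ : (xs : Vec A m) (ys : Vec A n) → drop m (xs ++ ys) ≡ ys
    drop-++ xs ys = V.++-injectiveʳ (take m (xs ++ ys)) xs (V.take++drop≡id m (xs ++ ys))

    op-++ : ∀ xs ys → op (xs ++ ys) ≡ S₁.op xs ∙ S₂.op ys
    op-++ xs ys = cong₂ (λ xs ys → S₁.op xs ∙ S₂.op ys) (take-++ xs ys) (drop-++ xs ys)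

    cell-++ : ∀ xs ys → cell (xs ++ ys) ≡ κ? (S₁.cell xs) (S₂.cell ys)
    cell-++ xs ys = cong₂ (λ xs ys → κ? (S₁.cell xs) (S₂.cell ys)) (take-++ xs ys) (drop-++ xs ys)

    op-≔ˡ : ∀ (xs : Vec A m) (ys : Vec A n) i {y} → op ((xs ++ ys) [ i ↑ˡ n ]≔ y) ≡ S₁.op (xs [ i ]≔ y) ∙ S₂.op ys
    op-≔ˡ xs ys i = trans (cong op (V.[]≔-++-↑ˡ xs ys i)) (op-++ _ ys)

    op-≔ʳ : ∀ (xs : Vec A m) (ys : Vec A n) i {y} → op ((xs ++ ys) [ m ↑ʳ i ]≔ y) ≡ S₁.op xs ∙ S₂.op (ys [ i ]≔ y)
    op-≔ʳ xs ys i = trans (cong op (V.[]≔-++-↑ʳ xs ys i)) (op-++ xs _)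

    -- A line runs inside one of the two blocks of variables, so only one factor of the product
    -- varies along it.
    ++-elim : (Q : Vec A (m + n) → Fin (m + n) → Set) → (∀ (xs : Vec A m) (ys : Vec A n) i → Q (xs ++ ys) (i ↑ˡ n)) →
              (∀ (xs : Vec A m) (ys : Vec A n) i → Q (xs ++ ys) (m ↑ʳ i)) → ∀ v j → Q v j
    ++-elim Q left right v j =
      subst (λ v → Q v j) (V.take++drop≡id m v) (subst (Q (take m v ++ drop m v)) (F.join-splitAt m n j) (by-side (splitAt m j)))
      where
      by-side : ∀ i → Q (take m v ++ drop m v) (join m n i)
      by-side (inj₁ i) = left (take m v) (drop m v) i
      by-side (inj₂ i) = right (take m v) (drop m v) i

    latin : Latin op
    latin = ++-elim (λ v j → ∀ {y z} → op (v [ j ]≔ y) ≡ op (v [ j ]≔ z) → y ≡ z)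
      (λ xs ys i eq → S₁.latin xs i (proj₂ ∙-cancellative _ _ _ (trans (sym (op-≔ˡ xs ys i)) (trans eq (op-≔ˡ xs ys i)))))
      (λ xs ys i eq → S₂.latin ys i (proj₁ ∙-cancellative _ _ _ (trans (sym (op-≔ʳ xs ys i)) (trans eq (op-≔ʳ xs ys i)))))

    inhabited : ∀ c → ∃ λ v → cell v ≡ just c
    inhabited c =
      let c₁ , c₂ , κ≡c = κ-onto c
          xs , xs∈c₁ = S₁.inhabited c₁
          ys , ys∈c₂ = S₂.inhabited c₂
      in xs ++ ys , trans (cell-++ xs ys) (trans (cong₂ κ? xs∈c₁ ys∈c₂) κ≡c)

    value : ∀ {v c} → cell v ≡ just c → P c (op v)
    value v∈c =
      let c₁ , c₂ , xs∈c₁ , ys∈c₂ , κ≡c = κ?-just _ _ v∈c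
      in proj₁ (κ-square κ≡c (S₁.value xs∈c₁) (S₂.value ys∈c₂))

    Closed : Vec A (m + n) → Fin (m + n) → Set
    Closed v j = ∀ {c} → cell v ≡ just c → ∃ λ y → cell (v [ j ]≔ y) ≡ just c × op (v [ j ]≔ y) ≡ φ (op v)

    closed : ∀ {v c} → cell v ≡ just c → ∀ j → ∃ λ y → cell (v [ j ]≔ y) ≡ just c × op (v [ j ]≔ y) ≡ φ (op v)
    closed v∈c j = ++-elim Closed left right _ j v∈c
      where
      left : ∀ (xs : Vec A m) (ys : Vec A n) i → Closed (xs ++ ys) (i ↑ˡ n)
      left xs ys i v∈c =
        let c₁ , c₂ , xs∈c₁ , ys∈c₂ , κ≡c = κ?-just _ _ (trans (sym (cell-++ xs ys)) v∈c)
            y , y∈c₁ , op-y = S₁.closed xs∈c₁ i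
            _ , square , _ = κ-square κ≡c (S₁.value xs∈c₁) (S₂.value ys∈c₂)
        in y , trans (cong cell (V.[]≔-++-↑ˡ xs ys i)) (trans (cell-++ _ ys) (trans (cong₂ κ? y∈c₁ ys∈c₂) κ≡c))
             , trans (op-≔ˡ xs ys i) (trans (cong (_∙ S₂.op ys) op-y) (trans square (cong φ (sym (op-++ xs ys)))))

      right : ∀ (xs : Vec A m) (ys : Vec A n) i → Closed (xs ++ ys) (m ↑ʳ i)
      right xs ys i v∈c =
        let c₁ , c₂ , xs∈c₁ , ys∈c₂ , κ≡c = κ?-just _ _ (trans (sym (cell-++ xs ys)) v∈c)
            y , y∈c₂ , op-y = S₂.closed ys∈c₂ i
            _ , _ , square = κ-square κ≡c (S₁.value xs∈c₁) (S₂.value ys∈c₂)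
        in y , trans (cong cell (V.[]≔-++-↑ʳ xs ys i)) (trans (cell-++ xs _) (trans (cong₂ κ? xs∈c₁ y∈c₂) κ≡c))
             , trans (op-≔ʳ xs ys i) (trans (cong (S₁.op xs ∙_) op-y) (trans square (cong φ (sym (op-++ xs ys)))))

-- Congruences and cyclic Latin squares.

%≡⇒∣∣-∣ : ∀ u v {p} .{{_ : NonZero p}} → u % p ≡ v % p → p ∣ ∣ u - v ∣
%≡⇒∣∣-∣ u v {p} eq = divides ∣ u / p - v / p ∣ (begin
  ∣ u - v ∣                                        ≡⟨ cong₂ ∣_-_∣ (m≡m%n+[m/n]*n u p) (m≡m%n+[m/n]*n v p) ⟩
  ∣ u % p + u / p * p - v % p + v / p * p ∣        ≡⟨ cong (λ r → ∣ r + u / p * p - v % p + v / p * p ∣) eq ⟩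
  ∣ v % p + u / p * p - v % p + v / p * p ∣        ≡⟨ ℕ.∣m+n-m+o∣≡∣n-o∣ (v % p) _ _ ⟩
  ∣ u / p * p - v / p * p ∣                        ≡⟨ ℕ.*-distribʳ-∣-∣ p (u / p) (v / p) ⟨
  ∣ u / p - v / p ∣ * p                            ∎)
  where open ≡-Reasoning

-- Two residues differ by less than `p`, and the only such multiple of `p` is zero.
∣∣-∣⇒≡ : ∀ {p} (x y : Fin p) → p ∣ ∣ toℕ x - toℕ y ∣ → x ≡ y
∣∣-∣⇒≡ {p} x y p∣x-y = F.toℕ-injective (ℕ.∣m-n∣≡0⇒m≡n (zero-multiple _ p∣x-y
  (ℕ.≤-<-trans (ℕ.∣m-n∣≤m⊔n (toℕ x) (toℕ y)) (ℕ.⊔-pres-<m (F.toℕ<n x) (F.toℕ<n y)))))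
  where
  zero-multiple : ∀ d → p ∣ d → d < p → d ≡ 0
  zero-multiple zero    p∣d d<p = refl
  zero-multiple (suc d) p∣d d<p = contradiction p∣d (>⇒∤ d<p)

module _ {p : ℕ} .{{_ : NonZero p}} where

  infixl 6 _⊕_

  _⊕_ : Op₂ (Fin p)
  x ⊕ y = (toℕ x + toℕ y) mod p

  next : Fin p → Fin p
  next x = suc (toℕ x) mod p

  toℕ-mod : ∀ u → toℕ (u mod p) ≡ u % p
  toℕ-mod u = F.toℕ-fromℕ< (m%n<n u p)

  mod≡⇒∣∣-∣ : ∀ u v → u mod p ≡ v mod p → p ∣ ∣ u - v ∣
  mod≡⇒∣∣-∣ u v eq = %≡⇒∣∣-∣ u v (trans (sym (toℕ-mod u)) (trans (cong toℕ eq) (toℕ-mod v)))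

  ⊕-comm : ∀ x y → x ⊕ y ≡ y ⊕ x
  ⊕-comm x y = cong (_mod p) (ℕ.+-comm (toℕ x) (toℕ y))

  ⊕-cancellative : Cancellative _≡_ _⊕_
  ⊕-cancellative = cancelˡ , λ x y z eq → cancelˡ x y z (trans (⊕-comm x y) (trans eq (⊕-comm z x)))
    where
    cancelˡ : ∀ x y z → x ⊕ y ≡ x ⊕ z → y ≡ z
    cancelˡ x y z eq = ∣∣-∣⇒≡ y z (subst (p ∣_) (ℕ.∣m+n-m+o∣≡∣n-o∣ (toℕ x) _ _) (mod≡⇒∣∣-∣ _ _ eq))

  next-injective : Injective _≡_ _≡_ next
  next-injective {x} {y} eq = ∣∣-∣⇒≡ x y (mod≡⇒∣∣-∣ _ _ eq)

  next≢id : 1 < p → ∀ x → next x ≢ x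
  next≢id 1<p x eq = ℕ.<⇒≱ 1<p (∣⇒≤ (subst (p ∣_) (∣1+m-m∣≡1 (toℕ x)) (%≡⇒∣∣-∣ (suc (toℕ x)) (toℕ x)
    (trans (sym (toℕ-mod (suc (toℕ x)))) (trans (cong toℕ eq) (sym (m<n⇒m%n≡m (F.toℕ<n x))))))))
    where
    ∣1+m-m∣≡1 : ∀ m → ∣ suc m - m ∣ ≡ 1
    ∣1+m-m∣≡1 zero    = refl
    ∣1+m-m∣≡1 (suc m) = ∣1+m-m∣≡1 m

  module _ (∣2*⇒∣ : ∀ {d} → p ∣ 2 * d → p ∣ d) where

    private
      ∣2x-2y∣⇒≡ : (x y : Fin p) → p ∣ ∣ toℕ x + toℕ x - toℕ y + toℕ y ∣ → x ≡ y
      ∣2x-2y∣⇒≡ x y p∣ = ∣∣-∣⇒≡ x y (∣2*⇒∣ (subst (p ∣_) (begin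
        ∣ toℕ x + toℕ x - toℕ y + toℕ y ∣  ≡⟨ cong₂ ∣_-_∣ (2*-+ (toℕ x)) (2*-+ (toℕ y)) ⟨
        ∣ 2 * toℕ x - 2 * toℕ y ∣          ≡⟨ ℕ.*-distribˡ-∣-∣ 2 (toℕ x) (toℕ y) ⟨
        2 * ∣ toℕ x - toℕ y ∣              ∎) p∣))
        where
        open ≡-Reasoning
        2*-+ : ∀ m → 2 * m ≡ m + m
        2*-+ m = cong (m +_) (ℕ.+-identityʳ m)

    double-injective : Injective _≡_ _≡_ (λ x → x ⊕ x)
    double-injective {x} {y} eq = ∣2x-2y∣⇒≡ x y (mod≡⇒∣∣-∣ _ _ eq)

    -- The entry is `2 x + 1` modulo `p`, so the parallel diagonal `y = next x` is a transversal for
    -- the same reason as the main one.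
    ⊕-next-injective : Injective _≡_ _≡_ (λ x → x ⊕ next x)
    ⊕-next-injective {x} {y} eq = ∣2x-2y∣⇒≡ x y
      (subst (p ∣_) (cong₂ ∣_-_∣ (ℕ.+-suc (toℕ x) (toℕ x)) (ℕ.+-suc (toℕ y) (toℕ y)))
        (%≡⇒∣∣-∣ (toℕ x + suc (toℕ x)) (toℕ y + suc (toℕ y)) (trans (sym (residue x)) (trans (cong toℕ eq) (residue y)))))
      where
      open ≡-Reasoning
      residue : ∀ x → toℕ (x ⊕ next x) ≡ (toℕ x + suc (toℕ x)) % p
      residue x = begin
        toℕ (x ⊕ next x)                            ≡⟨ toℕ-mod (toℕ x + toℕ (next x)) ⟩
        (toℕ x + toℕ (next x)) % p                  ≡⟨ cong (λ r → (toℕ x + r) % p) (toℕ-mod (suc (toℕ x))) ⟩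
        (toℕ x + suc (toℕ x) % p) % p               ≡⟨ %-distribˡ-+ (toℕ x) (suc (toℕ x) % p) p ⟩
        (toℕ x % p + suc (toℕ x) % p % p) % p       ≡⟨ cong (λ r → (toℕ x % p + r) % p) (m%n%n≡m%n (suc (toℕ x)) p) ⟩
        (toℕ x % p + suc (toℕ x) % p) % p           ≡⟨ %-distribˡ-+ (toℕ x) (suc (toℕ x)) p ⟨
        (toℕ x + suc (toℕ x)) % p                   ∎

-- With `p = 2 h + 1` one has `d * p = h * (2 * d) + d`, so `p` divides the last summand.
odd∣2*⇒∣ : ∀ h {d} → suc (2 * h) ∣ 2 * d → suc (2 * h) ∣ d
odd∣2*⇒∣ h {d} p∣2d = ∣m+n∣m⇒∣n (subst (suc (2 * h) ∣_) d*p≡h*2d+d (n∣m*n d)) (∣n⇒∣m*n h p∣2d)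
  where
  open ≡-Reasoning
  d*p≡h*2d+d : d * suc (2 * h) ≡ h * (2 * d) + d
  d*p≡h*2d+d = begin
    d * suc (2 * h)       ≡⟨ ℕ.*-suc d (2 * h) ⟩
    d + d * (2 * h)       ≡⟨ cong (d +_) (ℕ.*-comm d (2 * h)) ⟩
    d + 2 * h * d         ≡⟨ cong (λ a → d + a * d) (ℕ.*-comm 2 h) ⟩
    d + h * 2 * d         ≡⟨ cong (d +_) (ℕ.*-assoc h 2 d) ⟩
    d + h * (2 * d)       ≡⟨ ℕ.+-comm d _ ⟩
    h * (2 * d) + d       ∎

-- Latin squares of every order from 3 on whose main diagonal is a transversal.

record DiagonalSquare (q : ℕ) : Set where
  field
    _∙_          : Op₂ (Fin q)
    cancellative : Cancellative _≡_ _∙_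
    diagonal     : Injective _≡_ _≡_ (λ x → x ∙ x)

-- The square is extended by a row, a column and a symbol (all called zero here)
-- along the transversal y = next x, so that the diagonal stays a transversal.
prolong : ∀ {p} {_⊕_ : Op₂ (Fin p)} {next : Fin p → Fin p} → Cancellative _≡_ _⊕_ →
          Injective _≡_ _≡_ next → (∀ x → next x ≢ x) → Injective _≡_ _≡_ (λ x → x ⊕ x) →
          Injective _≡_ _≡_ (λ x → x ⊕ next x) → DiagonalSquare (suc p)
prolong {p} {_⊕_} {next} ⊕-cancellative next-injective next≢id diagonal-injective ⊕-next-injective =
  record { _∙_ = _∙_ ; cancellative = cancelˡ , cancelʳ ; diagonal = diagonal }
  where
  prev : Fin p → Fin p
  prev y = proj₁ (injective⇒surjective next-injective y)

  next-prev : ∀ y → next (prev y) ≡ y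
  next-prev y = proj₂ (injective⇒surjective next-injective y)

  _∙_ : Op₂ (Fin (suc p))
  zero  ∙ zero  = zero
  zero  ∙ suc y = suc (prev y ⊕ y)
  suc x ∙ zero  = suc (x ⊕ next x)
  suc x ∙ suc y with y F.≟ next x
  ... | yes _ = zero
  ... | no  _ = suc (x ⊕ y)

  prev-⊕-injective : ∀ y z → prev y ⊕ y ≡ prev z ⊕ z → y ≡ z
  prev-⊕-injective y z eq = trans (sym (next-prev y)) (trans (cong next (⊕-next-injective (trans (cong (prev y ⊕_) (next-prev y)) (trans eq (cong (prev z ⊕_) (sym (next-prev z))))))) (next-prev z))

  cancelˡ : ∀ x y z → x ∙ y ≡ x ∙ z → y ≡ z
  cancelˡ zero    zero    zero    eq = refl
  cancelˡ zero    (suc y) (suc z) eq = cong suc (prev-⊕-injective y z (F.suc-injective eq))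
  cancelˡ (suc x) zero    zero    eq = refl
  cancelˡ (suc x) zero    (suc z) eq with z F.≟ next x
  ... | no z≢ = contradiction (sym (proj₁ ⊕-cancellative x _ _ (F.suc-injective eq))) z≢
  cancelˡ (suc x) (suc y) zero    eq with y F.≟ next x
  ... | no y≢ = contradiction (proj₁ ⊕-cancellative x _ _ (F.suc-injective eq)) y≢
  cancelˡ (suc x) (suc y) (suc z) eq with y F.≟ next x | z F.≟ next x
  ... | yes y≡ | yes z≡ = cong suc (trans y≡ (sym z≡))
  ... | no  _  | no  _  = cong suc (proj₁ ⊕-cancellative x _ _ (F.suc-injective eq))

  cancelʳ : ∀ x y z → y ∙ x ≡ z ∙ x → y ≡ z
  cancelʳ zero    zero    zero    eq = refl
  cancelʳ zero    (suc y) (suc z) eq = cong suc (⊕-next-injective (F.suc-injective eq))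
  cancelʳ (suc x) zero    zero    eq = refl
  cancelʳ (suc x) zero    (suc z) eq with x F.≟ next z
  ... | no x≢ = contradiction (trans (sym (next-prev x)) (cong next (proj₂ ⊕-cancellative x _ _ (F.suc-injective eq)))) x≢
  cancelʳ (suc x) (suc y) zero    eq with x F.≟ next y
  ... | no x≢ = contradiction (trans (sym (next-prev x)) (cong next (proj₂ ⊕-cancellative x _ _ (F.suc-injective (sym eq))))) x≢
  cancelʳ (suc x) (suc y) (suc z) eq with x F.≟ next y | x F.≟ next z
  ... | yes x≡y′ | yes x≡z′ = cong suc (next-injective (trans (sym x≡y′) x≡z′))
  ... | no  _    | no  _    = cong suc (proj₂ ⊕-cancellative x _ _ (F.suc-injective eq))

  -- As `next` has no fixed point, the transversal used for the extension misses the diagonal and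
  -- leaves its entries in place.
  x∙x : ∀ x → suc x ∙ suc x ≡ suc (x ⊕ x)
  x∙x x with x F.≟ next x
  ... | yes x≡ = contradiction (sym x≡) (next≢id x)
  ... | no  _  = refl

  diagonal : ∀ {x y} → x ∙ x ≡ y ∙ y → x ≡ y
  diagonal {zero}  {zero}  eq = refl
  diagonal {zero}  {suc y} eq = contradiction (trans eq (x∙x y)) F.0≢1+n
  diagonal {suc x} {zero}  eq = contradiction (trans (sym eq) (x∙x x)) F.0≢1+n
  diagonal {suc x} {suc y} eq = cong suc (diagonal-injective (F.suc-injective (trans (sym (x∙x x)) (trans eq (x∙x y)))))

diagonalSquare-odd : ∀ h → DiagonalSquare (suc (2 * h))
diagonalSquare-odd h = record
  { _∙_ = _⊕_ ; cancellative = ⊕-cancellative ; diagonal = double-injective (odd∣2*⇒∣ h) }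

-- A cyclic square of even order has no transversal, so the cyclic square of the odd order one below
-- is prolonged.
diagonalSquare-even : ∀ h → DiagonalSquare (suc (suc (2 * suc h)))
diagonalSquare-even h = prolong ⊕-cancellative next-injective (next≢id (s<s z<s))
  (double-injective (odd∣2*⇒∣ (suc h))) (⊕-next-injective (odd∣2*⇒∣ (suc h)))

-- Sizes of products, vectors and one-point extensions.

×-finite : ∀ {A B : Set} {m n} → A ↔ Fin m → B ↔ Fin n → (A × B) ↔ Fin (m * n)
×-finite A↔m B↔n = ↔-sym F.*↔× ↔-∘ (A↔m ×-↔ B↔n)

Vec-finite : ∀ {A : Set} {m} → A ↔ Fin m → ∀ n → Vec A n ↔ Fin (m ^ n)
Vec-finite A↔m zero    = mk↔ₛ′ (λ _ → zero) (λ _ → []) (λ { zero → refl }) (λ { [] → refl })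
Vec-finite A↔m (suc n) = ×-finite A↔m (Vec-finite A↔m n) ↔-∘
  mk↔ₛ′ (λ { (x ∷ v) → x , v }) (λ { (x , v) → x ∷ v }) (λ { (x , v) → refl }) (λ { (x ∷ v) → refl })

Maybe-finite : ∀ {A : Set} {m} → A ↔ Fin m → Maybe A ↔ Fin (suc m)
Maybe-finite A↔m = mk↔ₛ′
  (λ { nothing → zero ; (just a) → suc (to A↔m a) })
  (λ { zero → nothing ; (suc i) → just (from A↔m i) })
  (λ { zero → refl ; (suc i) → cong suc (strictlyInverseˡ A↔m i) })
  (λ { nothing → refl ; (just a) → cong just (strictlyInverseʳ A↔m a) })

Bool-finite : Bool ↔ Fin 2
Bool-finite = ↔-sym F.2↔Bool

-- Orders divisible by 2 or by 3.

atLeast-even : ∀ q n → AtLeast n (suc q * 2) (2 ^ (suc q ^ n))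
atLeast-even q n = subst (λ c → AtLeast n (suc q * 2) (2 ^ c)) (ℕ.*-identityˡ (suc q ^ n))
  (family⇒AtLeast (×-finite (↔-id _) Bool-finite) (×-finite (↔-sym F.1↔⊤) (Vec-finite (↔-id _) n))
    (wreath (foldr′ _⊕_ zero) (foldr-latin ⊕-cancellative) (parityFamily n)))

-- `sign true` is negation modulo 3.
sign : Bool → Fin 3 → Fin 3
sign false x  = x
sign true  0F = 0F
sign true  1F = 2F
sign true  2F = 1F

sign-involutive : ∀ b x → sign b (sign b x) ≡ x
sign-involutive false x  = refl
sign-involutive true  0F = refl
sign-involutive true  1F = refl
sign-involutive true  2F = refl

-- The linear forms `± x₁ ± … ± xₙ` modulo 3, with one free sign per variable.
signFamily : ∀ n → Family (Fin 3) (Fin n) n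
signFamily n = record { op = op ; latin = latin ; separate = separate }
  where
  op : ∀ {n} → (Fin n → Bool) → Vec (Fin 3) n → Fin 3
  op s []      = 0F
  op s (x ∷ v) = sign (s zero) x ⊕ op (s ∘ suc) v

  latin : ∀ {n} (s : Fin n → Bool) → Latin (op s)
  latin s (_ ∷ v) zero {y} {z} eq = trans (sym (sign-involutive (s zero) y))
    (trans (cong (sign (s zero)) (proj₂ ⊕-cancellative (op (s ∘ suc) v) (sign (s zero) y) (sign (s zero) z) eq))
      (sign-involutive (s zero) z))
  latin s (x ∷ v) (suc j) {y} {z} eq = latin (s ∘ suc) v j
    (proj₁ ⊕-cancellative (sign (s zero) x) (op (s ∘ suc) (v [ j ]≔ y)) (op (s ∘ suc) (v [ j ]≔ z)) eq)

  op-zeros : ∀ {n} (s : Fin n → Bool) → op s (replicate n 0F) ≡ 0F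
  op-zeros {zero}  s = refl
  op-zeros {suc n} s with s zero
  ... | true  = cong (0F ⊕_) (op-zeros (s ∘ suc))
  ... | false = cong (0F ⊕_) (op-zeros (s ∘ suc))

  op-one : ∀ {n} (s : Fin (suc n) → Bool) → op s (1F ∷ replicate n 0F) ≡ (if s zero then 2F else 1F)
  op-one s with s zero
  ... | true  = cong (2F ⊕_) (op-zeros (s ∘ suc))
  ... | false = cong (1F ⊕_) (op-zeros (s ∘ suc))

  op-0∷ : ∀ {n} (s : Fin (suc n) → Bool) v → op s (0F ∷ v) ≡ 0F ⊕ op (s ∘ suc) v
  op-0∷ s v with s zero
  ... | true  = refl
  ... | false = refl

  separate : ∀ {n} (i : Fin n) s t → s i ≢ t i → ∃ λ v → op s v ≢ op t v
  -- At the unit vector of the differing coordinate the form equals 1 or 2 and so reveals its sign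
  -- there; zeros contribute nothing under either sign.
  separate {suc n} zero s t s≢t = 1F ∷ replicate n 0F , λ eq →
    s≢t (read (s zero) (t zero) (trans (sym (op-one s)) (trans eq (op-one t))))
    where
    read : ∀ b b′ → _≡_ {A = Fin 3} (if b then 2F else 1F) (if b′ then 2F else 1F) → b ≡ b′
    read true  true  _ = refl
    read false false _ = refl
  separate (suc i) s t s≢t =
    let v , op≢ = separate i (s ∘ suc) (t ∘ suc) s≢t
    in 0F ∷ v , λ eq → op≢ (proj₁ ⊕-cancellative 0F (op (s ∘ suc) v) (op (t ∘ suc) v)
         (trans (sym (op-0∷ s v)) (trans eq (op-0∷ t v))))

atLeast-triple : ∀ q n → AtLeast n (suc q * 3) (2 ^ (n * suc q ^ n))
atLeast-triple q n =
  family⇒AtLeast (×-finite (↔-id _) (↔-id _)) (×-finite (↔-id _) (Vec-finite (↔-id _) n))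
    (wreath (foldr′ _⊕_ zero) (foldr-latin ⊕-cancellative) (signFamily n))

-- Odd orders `2 q + 1`: an alphabet of `q` pairs and one further letter.

Pairs : ℕ → Set
Pairs q = Maybe (Fin q × Bool)

Pairs-finite : ∀ q → Pairs q ↔ Fin (suc (q * 2))
Pairs-finite q = Maybe-finite (×-finite (↔-id _) Bool-finite)

mate : ∀ {q} → Pairs q → Pairs q
mate = Maybe.map (map₂ not)

mate-involutive : ∀ {q} (u : Pairs q) → mate (mate u) ≡ u
mate-involutive nothing        = refl
mate-involutive (just (i , a)) = cong (λ a → just (i , a)) (B.not-involutive a)

InPair : ∀ {q} → Fin q → Pairs q → Set
InPair i u = ∃ λ a → u ≡ just (i , a)

mate-moves : ∀ {q} {i : Fin q} {u} → InPair i u → mate u ≢ u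
mate-moves (true  , refl) ()
mate-moves (false , refl) ()

pairSwitching : ∀ q → Switching (Pairs q) mate 1 InPair
pairSwitching q = unary (Maybe.map proj₁)
  (λ i → just (i , false) , refl)
  (λ { {just (i , a)} refl → a , refl })
  (λ { {just (i , a)} refl → refl })

module OddOrder {q} (D : DiagonalSquare q) where
  open DiagonalSquare D

  infixl 7 _⋆_

  -- Together with the products involving `nothing`, this is the idempotent square of order 3 on the
  -- pair `i` and `nothing`, with `i` renamed `i ∙ i` in the values.
  diagonalBlock : Fin q → Bool → Bool → Pairs q
  diagonalBlock i a b = if a xor b then nothing else just (i ∙ i , a)

  -- Off the diagonal the entry i ∙ j is replaced by an intercalate; on the diagonal the pair i
  -- and nothing form a subsquare of order 3.
  _⋆_ : Op₂ (Pairs q)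
  nothing      ⋆ nothing      = nothing
  nothing      ⋆ just (j , b) = just (j ∙ j , not b)
  just (i , a) ⋆ nothing      = just (i ∙ i , not a)
  just (i , a) ⋆ just (j , b) with i F.≟ j
  ... | yes _ = diagonalBlock i a b
  ... | no  _ = just (i ∙ j , a xor b)

  ⋆-intercalate : ∀ {i j} → i ≢ j → ∀ a b → just (i , a) ⋆ just (j , b) ≡ just (i ∙ j , a xor b)
  ⋆-intercalate {i} {j} i≢j a b with i F.≟ j
  ... | yes i≡j = contradiction i≡j i≢j
  ... | no  _   = refl

  private
    just-pair : ∀ {i j : Fin q} {a b : Bool} → just (i , a) ≡ just (j , b) → i ≡ j × a ≡ b
    just-pair refl = refl , refl

    diagonalBlock-just : ∀ {i k c} a b → diagonalBlock i a b ≡ just (k , c) → i ∙ i ≡ k × a ≡ c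
    diagonalBlock-just true  true  eq = just-pair eq
    diagonalBlock-just false false eq = just-pair eq

    diagonalBlock-injective : ∀ {i} a b c → diagonalBlock i a b ≡ diagonalBlock i a c → b ≡ c
    diagonalBlock-injective true  true  true  _ = refl
    diagonalBlock-injective true  false false _ = refl
    diagonalBlock-injective false true  true  _ = refl
    diagonalBlock-injective false false false _ = refl

  -- In the row of `nothing` the pairs are distinct because the diagonal of `∙` is a transversal. In
  -- the row of `just (i , a)` the pair of the product separates the blocks off the diagonal, and
  -- the bits decide inside each block.
  ⋆-cancelˡ : ∀ u v w → u ⋆ v ≡ u ⋆ w → v ≡ w
  ⋆-cancelˡ nothing nothing nothing eq = refl
  ⋆-cancelˡ nothing (just (j , b)) (just (k , c)) eq =
    let j∙j≡k∙k , b≡c = just-pair eq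
    in cong₂ (λ i a → just (i , a)) (diagonal j∙j≡k∙k) (B.not-injective b≡c)
  ⋆-cancelˡ (just (i , a)) nothing nothing eq = refl
  ⋆-cancelˡ (just (i , a)) nothing (just (k , c)) eq with i F.≟ k
  ... | yes _  = contradiction (proj₂ (diagonalBlock-just a c (sym eq))) (B.not-¬ refl)
  ... | no i≢k = contradiction (proj₁ cancellative i _ _ (proj₁ (just-pair eq))) i≢k
  ⋆-cancelˡ (just (i , a)) (just (j , b)) nothing eq with i F.≟ j
  ... | yes _  = contradiction (proj₂ (diagonalBlock-just a b eq)) (B.not-¬ refl)
  ... | no i≢j = contradiction (sym (proj₁ cancellative i _ _ (proj₁ (just-pair eq)))) i≢j
  ⋆-cancelˡ (just (i , a)) (just (j , b)) (just (k , c)) eq with i F.≟ j | i F.≟ k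
  ... | yes refl | yes refl = cong (λ a → just (i , a)) (diagonalBlock-injective a b c eq)
  ... | yes refl | no i≢k   = contradiction (proj₁ cancellative i _ _ (proj₁ (diagonalBlock-just a b eq))) i≢k
  ... | no i≢j   | yes refl = contradiction (proj₁ cancellative i _ _ (proj₁ (diagonalBlock-just a c (sym eq)))) i≢j
  ... | no _     | no _     =
    let i∙j≡i∙k , ab≡ac = just-pair eq
    in cong₂ (λ i a → just (i , a)) (proj₁ cancellative i j k i∙j≡i∙k) (proj₁ xor-cancellative a b c ab≡ac)

transpose : ∀ {q} → DiagonalSquare q → DiagonalSquare q
transpose D = record
  { _∙_          = λ x y → y ∙ x
  ; cancellative = proj₂ cancellative , proj₁ cancellative
  ; diagonal     = diagonal
  }
  where open DiagonalSquare D

module _ {q} (D : DiagonalSquare (suc q)) where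
  open DiagonalSquare D
  open OddOrder D
  open OddOrder (transpose D) using () renaming (_⋆_ to _⋆ᵀ_; ⋆-cancelˡ to ⋆ᵀ-cancelˡ)

  -- The blow-up commutes with transposition, which reduces right cancellation to left cancellation
  -- for the transposed square.
  ⋆-transpose : ∀ u v → u ⋆ v ≡ v ⋆ᵀ u
  ⋆-transpose nothing        nothing        = refl
  ⋆-transpose nothing        (just _)       = refl
  ⋆-transpose (just _)       nothing        = refl
  ⋆-transpose (just (i , a)) (just (j , b)) with i F.≟ j | j F.≟ i
  ... | yes refl | yes _  = diagonalBlock-symmetric a b
    where
    diagonalBlock-symmetric : ∀ a b → diagonalBlock i a b ≡ diagonalBlock i b a
    diagonalBlock-symmetric true  true  = refl
    diagonalBlock-symmetric true  false = refl
    diagonalBlock-symmetric false true  = refl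
    diagonalBlock-symmetric false false = refl
  ... | yes i≡j  | no j≢i = contradiction (sym i≡j) j≢i
  ... | no i≢j   | yes j≡i = contradiction (sym j≡i) i≢j
  ... | no _     | no _   = cong (λ c → just (i ∙ j , c)) (B.xor-comm a b)

  ⋆-cancellative : Cancellative _≡_ _⋆_
  ⋆-cancellative = ⋆-cancelˡ , λ u v w eq →
    ⋆ᵀ-cancelˡ u v w (trans (sym (⋆-transpose v u)) (trans eq (⋆-transpose w u)))

  -- Cell n labels the boxes of n + 1 pairs on which no partial product meets the diagonal:
  -- each new pair has to avoid the one containing the product of the others.
  Cell : ℕ → Set
  Cell zero    = Fin (suc q)
  Cell (suc n) = Fin q × Cell n

  #cells : ℕ → ℕ
  #cells zero    = suc q
  #cells (suc n) = q * #cells n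

  Cell-finite : ∀ n → Cell n ↔ Fin (#cells n)
  Cell-finite zero    = ↔-id _
  Cell-finite (suc n) = ×-finite (↔-id _) (Cell-finite n)

  -- The pair holding all values taken on the cell. The index `r` numbers the pairs other than
  -- `pairOf n c`, and `punchIn` decodes it.
  pairOf : ∀ n → Cell n → Fin (suc q)
  pairOf zero    i       = i
  pairOf (suc n) (r , c) = punchIn (pairOf n c) r ∙ pairOf n c

  extend : ∀ n → Fin (suc q) → Cell n → Maybe (Cell (suc n))
  extend n i c with pairOf n c F.≟ i
  ... | yes _   = nothing
  ... | no  c≢i = just (punchOut c≢i , c)

  extend-onto : ∀ n c → ∃₂ λ i c′ → extend n i c′ ≡ just c
  extend-onto n (r , c) = punchIn (pairOf n c) r , c , extend-punchIn
    where
    extend-punchIn : extend n (punchIn (pairOf n c) r) c ≡ just (r , c)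
    extend-punchIn with pairOf n c F.≟ punchIn (pairOf n c) r
    ... | yes eq = contradiction (sym eq) (F.punchInᵢ≢i (pairOf n c) r)
    ... | no  c≢ = cong (λ r → just (r , c)) (trans (F.punchOut-cong (pairOf n c) refl) (F.punchOut-punchIn (pairOf n c)))

  -- Distinct pairs meet off the diagonal, where the bit of the product is `a xor b`; flipping
  -- either bit flips it.
  extend-square : ∀ n {i c c′ u w} → extend n i c ≡ just c′ → InPair i u → InPair (pairOf n c) w →
                  InPair (pairOf (suc n) c′) (u ⋆ w) × mate u ⋆ w ≡ mate (u ⋆ w) × u ⋆ mate w ≡ mate (u ⋆ w)
  extend-square n {i} {c} eq (a , refl) (b , refl) with pairOf n c F.≟ i
  extend-square n {i} {c} refl (a , refl) (b , refl) | no c≢i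
    rewrite ⋆-intercalate (c≢i ∘ sym) a b
          | ⋆-intercalate (c≢i ∘ sym) (not a) b
          | ⋆-intercalate (c≢i ∘ sym) a (not b)
          | F.punchIn-punchOut c≢i
          = (a xor b , refl)
          , cong (λ c → just (_ , c)) (sym (B.not-distribˡ-xor a b))
          , cong (λ c → just (_ , c)) (sym (B.not-distribʳ-xor a b))

  cellSwitching : ∀ n → Switching (Pairs (suc q)) mate (suc n) (InPair ∘ pairOf n)
  cellSwitching zero    = pairSwitching (suc q)
  cellSwitching (suc n) = compose ⋆-cancellative (extend n) (extend-onto n) (extend-square n)
    (pairSwitching (suc q)) (cellSwitching n)

  atLeast-cells : ∀ n → AtLeast (suc n) (suc (suc q * 2)) (2 ^ #cells n)
  atLeast-cells n = family⇒AtLeast (Pairs-finite (suc q)) (Cell-finite n)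
    (switching⇒family mate-involutive mate-moves (cellSwitching n))

  -- The factor 3/2 is gained once, from the `suc q` pairs available to the first variable; each
  -- further variable contributes `q`, which is at least `m`.
  #cells-bound : ∀ {m} → m ≤ q → 3 * m ≤ 2 * suc q → ∀ n → 3 * m ^ suc n ≤ 2 * #cells n
  #cells-bound {m} m≤q 3m≤ zero    = subst (λ m → 3 * m ≤ 2 * suc q) (sym (ℕ.*-identityʳ m)) 3m≤
  #cells-bound {m} m≤q 3m≤ (suc n) = begin
    3 * (m * m ^ suc n)    ≡⟨ *-Semigroup.x∙yz≈y∙xz 3 m (m ^ suc n) ⟩
    m * (3 * m ^ suc n)    ≤⟨ ℕ.*-mono-≤ m≤q (#cells-bound m≤q 3m≤ n) ⟩
    q * (2 * #cells n)     ≡⟨ *-Semigroup.x∙yz≈y∙xz q 2 (#cells n) ⟩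
    2 * (q * #cells n)     ∎
    where open ℕ.≤-Reasoning

-- Order 5: a square with one intercalate and its cells.

all-vectors? : ∀ {m n} {P : Vec (Fin m) n → Set} → Decidable P → Dec (∀ v → P v)
all-vectors? {n = zero}  P? = map′ (λ { p [] → p }) (λ p → p []) (P? [])
all-vectors? {n = suc n} P? = map′ (λ { p (x ∷ v) → p x v }) (λ p x v → p (x ∷ v))
  (F.all? λ x → all-vectors? (P? ∘ (x ∷_)))

infixl 7 _◇_

-- A loop with identity 0 in which every square is 0, so that {0, 1} is a subloop.
_◇_ : Op₂ (Fin 5)
x ◇ y = lookup (lookup table x) y
  where
  table : Vec (Vec (Fin 5) 5) 5
  table = (0F ∷ 1F ∷ 2F ∷ 3F ∷ 4F ∷ [])
        ∷ (1F ∷ 0F ∷ 3F ∷ 4F ∷ 2F ∷ [])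
        ∷ (2F ∷ 4F ∷ 0F ∷ 1F ∷ 3F ∷ [])
        ∷ (3F ∷ 2F ∷ 4F ∷ 0F ∷ 1F ∷ [])
        ∷ (4F ∷ 3F ∷ 1F ∷ 2F ∷ 0F ∷ [])
        ∷ []

◇-cancellative : Cancellative _≡_ _◇_
◇-cancellative =
  from-yes (F.all? λ x → F.all? λ y → F.all? λ z → (x ◇ y F.≟ x ◇ z) →-dec (y F.≟ z)) ,
  from-yes (F.all? λ x → F.all? λ y → F.all? λ z → (y ◇ x F.≟ z ◇ x) →-dec (y F.≟ z))

swap₀₁ : Fin 5 → Fin 5
swap₀₁ 0F = 1F
swap₀₁ 1F = 0F
swap₀₁ (suc (suc x)) = suc (suc x)

swap₀₁-involutive : ∀ x → swap₀₁ (swap₀₁ x) ≡ x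
swap₀₁-involutive 0F            = refl
swap₀₁-involutive 1F            = refl
swap₀₁-involutive (suc (suc x)) = refl

Low : Fin 5 → Set
Low x = x ≡ 0F ⊎ x ≡ 1F

low? : Fin 5 → Bool
low? 0F = true
low? 1F = true
low? _  = false

swap₀₁-moves : ∀ {x} → Low x → swap₀₁ x ≢ x
swap₀₁-moves (inj₁ refl) ()
swap₀₁-moves (inj₂ refl) ()

◇-square : ∀ {x y} → Low x → Low y →
           Low (x ◇ y) × swap₀₁ x ◇ y ≡ swap₀₁ (x ◇ y) × x ◇ swap₀₁ y ≡ swap₀₁ (x ◇ y)
◇-square (inj₁ refl) (inj₁ refl) = inj₁ refl , refl , refl
◇-square (inj₁ refl) (inj₂ refl) = inj₂ refl , refl , refl
◇-square (inj₂ refl) (inj₁ refl) = inj₂ refl , refl , refl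
◇-square (inj₂ refl) (inj₂ refl) = inj₁ refl , refl , refl

Switching₅ : ℕ → ℕ → Set
Switching₅ n M = Switching (Fin 5) swap₀₁ n {Fin M} (const Low)

-- All cells take their values in the intercalate {0, 1}, so every product of cells is kept and
-- their numbers multiply.
compose₅ : ∀ {m n M N} → Switching₅ m M → Switching₅ n N → Switching₅ (m + n) (M * N)
compose₅ {M = M} {N} = compose ◇-cancellative (λ i j → just (combine i j))
  (λ c → let i , j , eq = F.combine-surjective {M} {N} c in i , j , cong just eq)
  (λ _ → ◇-square)

module _ {n M} (cell : Vec (Fin 5) n → Maybe (Fin M)) where

  private
    op : Vec (Fin 5) n → Fin 5
    -- Since 0 is the identity of `◇`, starting the fold with it leaves the product of the letters
    -- unchanged.
    op = foldr′ _◇_ 0F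

  -- The conditions on a concrete cell concern finitely many vectors and are settled by evaluation.
  value? : Dec (∀ v c → cell v ≡ just c → Low (op v))
  value? = all-vectors? λ v → F.all? λ c → ≡-dec F._≟_ (cell v) (just c) →-dec (op v F.≟ 0F ⊎-dec op v F.≟ 1F)

  closed? : Dec (∀ v c → cell v ≡ just c → ∀ j → ∃ λ y → cell (v [ j ]≔ y) ≡ just c × op (v [ j ]≔ y) ≡ swap₀₁ (op v))
  closed? = all-vectors? λ v → F.all? λ c → ≡-dec F._≟_ (cell v) (just c) →-dec F.all? λ j → F.any? λ y →
    ≡-dec F._≟_ (cell (v [ j ]≔ y)) (just c) ×-dec (op (v [ j ]≔ y) F.≟ swap₀₁ (op v))

-- The entries 0 and 1 outside the subsquare {0,1}² form a single cycle, of length six.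
binarySwitching : Switching₅ 2 2
binarySwitching = record
  { op        = foldr′ _◇_ 0F
  ; latin     = foldr-latin ◇-cancellative
  ; cell      = cell
  ; inhabited = λ { 0F → 0F ∷ 0F ∷ [] , refl ; 1F → 2F ∷ 2F ∷ [] , refl }
  ; value     = λ {v} → from-yes (value? cell) v _
  ; closed    = λ {v} → from-yes (closed? cell) v _
  }
  where
  cell : Vec (Fin 5) 2 → Maybe (Fin 2)
  -- A value in {0, 1} in a row from {0, 1} forces the column into {0, 1}, so `x` alone
  -- distinguishes the two cells.
  cell v@(x ∷ _ ∷ []) = if low? (foldr′ _◇_ 0F v) then just (if low? x then 0F else 1F) else nothing

-- In x ◇ (y ◇ z) the two cells of y ◇ z occur with x in {0,1}, and there is one more cell.
ternarySwitching : Switching₅ 3 3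
ternarySwitching = record
  { op        = foldr′ _◇_ 0F
  ; latin     = foldr-latin ◇-cancellative
  ; cell      = cell
  ; inhabited = λ { 0F → 0F ∷ 0F ∷ 0F ∷ [] , refl ; 1F → 0F ∷ 2F ∷ 2F ∷ [] , refl ; 2F → 2F ∷ 0F ∷ 2F ∷ [] , refl }
  ; value     = λ {v} → from-yes (value? cell) v _
  ; closed    = λ {v} → from-yes (closed? cell) v _
  }
  where
  cell : Vec (Fin 5) 3 → Maybe (Fin 3)
  cell v@(x ∷ y ∷ _ ∷ []) = if low? (foldr′ _◇_ 0F v)
    then just (if low? x then (if low? y then 0F else 1F) else 2F) else nothing

-- Growth of the number of cells in order 5.

^-distribʳ-* : ∀ e m n → (m * n) ^ e ≡ m ^ e * n ^ e
^-distribʳ-* zero    m n = refl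
^-distribʳ-* (suc e) m n = trans (cong (m * n *_) (^-distribʳ-* e m n)) (*-Semigroup.interchange m n (m ^ e) (n ^ e))

-- The bound M ≥ 3 ^ (n/3 - 10/139), cleared of roots and quotients.  The constant 10/139 has to
-- be at least 4/3 - log₃ 4 = 0.07147…, for n ≡ 1 mod 3.
record Exceeds (n M : ℕ) : Set where
  constructor exceeds
  field bound : 3 ^ (n * 139) ≤ M ^ (3 * 139) * 3 ^ (3 * 10)

-- Three more variables with three times as many cells multiply both sides by `3 ^ (3 * q)`, so the
-- loss `s` does not grow.
^-scale : ∀ n q s M → 3 ^ (n * q) ≤ M ^ (3 * q) * s → 3 ^ ((3 + n) * q) ≤ (3 * M) ^ (3 * q) * s
^-scale n q s M bound = begin
  3 ^ ((3 + n) * q)                      ≡⟨ cong (3 ^_) (ℕ.*-distribʳ-+ q 3 n) ⟩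
  3 ^ (3 * q + n * q)                    ≡⟨ ℕ.^-distribˡ-+-* 3 (3 * q) (n * q) ⟩
  3 ^ (3 * q) * 3 ^ (n * q)              ≤⟨ ℕ.*-monoʳ-≤ (3 ^ (3 * q)) bound ⟩
  3 ^ (3 * q) * (M ^ (3 * q) * s)        ≡⟨ ℕ.*-assoc (3 ^ (3 * q)) (M ^ (3 * q)) s ⟨
  3 ^ (3 * q) * M ^ (3 * q) * s          ≡⟨ cong (_* s) (^-distribʳ-* (3 * q) 3 M) ⟨
  (3 * M) ^ (3 * q) * s                  ∎
  where open ℕ.≤-Reasoning

exceeds-scale : ∀ {n M} → Exceeds n M → Exceeds (3 + n) (3 * M)
exceeds-scale {n} {M} (exceeds bound) = exceeds (^-scale n 139 (3 ^ (3 * 10)) M bound)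

-- Two, three and four variables start the three residue classes modulo 3.
switching₅ : ∀ n → ∃ λ M → Switching₅ (2 + n) M × Exceeds (2 + n) M
switching₅ zero                = 2 , binarySwitching , exceeds (ℕ.≤ᵇ⇒≤ _ _ tt)
switching₅ (suc zero)          = 3 , ternarySwitching , exceeds (ℕ.≤ᵇ⇒≤ _ _ tt)
switching₅ (suc (suc zero))    = 4 , compose₅ binarySwitching binarySwitching , exceeds (ℕ.≤ᵇ⇒≤ _ _ tt)
switching₅ (suc (suc (suc n))) =
  let M , S , M-exceeds = switching₅ n in 3 * M , compose₅ ternarySwitching S , exceeds-scale M-exceeds

atLeast₅ : ∀ n → ∃ λ M → AtLeast (suc n) 5 (2 ^ M) × Exceeds (suc n) M
-- In one variable two disjoint pairs of letters are switched; the single cell {0, 1} would not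
-- reach the bound.
atLeast₅ zero    = 2 , family⇒AtLeast (Pairs-finite 2) (↔-id _)
  (switching⇒family mate-involutive mate-moves (pairSwitching 2)) , exceeds (ℕ.≤ᵇ⇒≤ _ _ tt)
atLeast₅ (suc n) =
  let M , S , M-exceeds = switching₅ n
  in M , family⇒AtLeast (↔-id _) (↔-id _) (switching⇒family swap₀₁-involutive swap₀₁-moves S) , M-exceeds

^-cancel-< : ∀ e {m n} → m ^ e < n ^ e → m < n
^-cancel-< e m^e<n^e = ℕ.≰⇒> λ n≤m → ℕ.<⇒≱ m^e<n^e (ℕ.^-monoˡ-≤ e n≤m)

-- The bound puts `M` at or above the real exponent, so `a / b` lies below `M`; this is seen by
-- comparing powers with exponent `3 * q`.
exceeds⇒AtLeast2^3^ : ∀ n p q M → AtLeast n 5 (2 ^ M) →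
                      3 ^ (n * q) ≤ M ^ (3 * q) * 3 ^ (3 * p) → AtLeast2^3^ n p q
exceeds⇒AtLeast2^3^ n p q M atLeast bound a b 0<b below = 2 ^ M , atLeast , (begin
  2 ^ a         ≤⟨ ℕ.^-monoʳ-≤ 2 (ℕ.<⇒≤ a<M*b) ⟩
  2 ^ (M * b)   ≡⟨ ℕ.^-*-assoc 2 M b ⟨
  (2 ^ M) ^ b   ∎)
  where
  open ℕ.≤-Reasoning

  a<M*b : a < M * b
  a<M*b = ^-cancel-< (3 * q) (ℕ.*-cancelʳ-< (3 ^ (3 * p)) (a ^ (3 * q)) ((M * b) ^ (3 * q)) (begin-strict
    a ^ (3 * q) * 3 ^ (3 * p)                    <⟨ below ⟩
    3 ^ (n * q) * b ^ (3 * q)                    ≤⟨ ℕ.*-monoˡ-≤ (b ^ (3 * q)) bound ⟩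
    M ^ (3 * q) * 3 ^ (3 * p) * b ^ (3 * q)      ≡⟨ *-Semigroup.xy∙z≈xz∙y (M ^ (3 * q)) (3 ^ (3 * p)) (b ^ (3 * q)) ⟩
    M ^ (3 * q) * b ^ (3 * q) * 3 ^ (3 * p)      ≡⟨ cong (_* 3 ^ (3 * p)) (^-distribʳ-* (3 * q) M b) ⟨
    (M * b) ^ (3 * q) * 3 ^ (3 * p)              ∎))

-- p and q stay variables, as powers with the literal exponent 3 * 139 would be unfolded in conversion.
atLeast2^3^₅ : ∀ n p q → p ≡ 10 → q ≡ 139 → 0 < n → AtLeast2^3^ n p q
atLeast2^3^₅ (suc n) p q refl refl _ =
  let M , atLeast , exceeds bound = atLeast₅ n in exceeds⇒AtLeast2^3^ (suc n) 10 139 M atLeast bound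

-- The remaining odd orders, and the collection of all cases.

parity : ∀ n → ∃ λ h → n ≡ 2 * h ⊎ n ≡ suc (2 * h)
parity zero    = 0 , inj₁ refl
parity (suc n) with parity n
... | h , inj₁ n≡2h   = h , inj₂ (cong suc n≡2h)
... | h , inj₂ n≡1+2h = suc h , inj₁ (trans (cong suc n≡1+2h) (sym (ℕ.*-suc 2 h)))

diagonalSquare : ∀ n → DiagonalSquare (3 + n)
diagonalSquare n with parity n
... | h , inj₁ n≡2h   = subst (DiagonalSquare ∘ suc) (trans (ℕ.*-suc 2 h) (cong (2 +_) (sym n≡2h))) (diagonalSquare-odd (suc h))
... | h , inj₂ n≡1+2h = subst (DiagonalSquare ∘ suc)
  (trans (cong suc (ℕ.*-suc 2 h)) (cong (2 +_) (sym n≡1+2h))) (diagonalSquare-even h)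

atLeast-odd : ∀ k n → 3 < k → ¬ (2 ∣ k) → ¬ (3 ∣ k) → k ≢ 5 →
              ∃ λ N → AtLeast (suc n) k N × 2 ^ (3 * (k / 3) ^ suc n) ≤ N * N
atLeast-odd k n 3<k 2∤k 3∤k k≢5 with parity k
... | h , inj₁ k≡2h = contradiction (divides h (trans k≡2h (ℕ.*-comm 2 h))) 2∤k
... | 0 , inj₂ refl = contradiction 3<k (ℕ.≤⇒≯ (s≤s z≤n))
... | 1 , inj₂ refl = contradiction 3<k (ℕ.n≮n 3)
-- Here the square to be blown up would have order 2, and no Latin square of order 2 has a
-- transversal.
... | 2 , inj₂ refl = contradiction refl k≢5
... | suc (suc (suc h)) , inj₂ refl =
  2 ^ #cells D n , subst (λ k → AtLeast (suc n) (suc k) (2 ^ #cells D n)) (ℕ.*-comm (3 + h) 2) (atLeast-cells D n) , bound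
  where
  open ℕ.≤-Reasoning
  D = diagonalSquare h
  m = k / 3

  m*3≤2q : m * 3 ≤ 2 * (3 + h)
  -- As 3 does not divide `k = 2 q + 1`, the inequality `m * 3 ≤ k` is strict, which gives
  -- `m * 3 ≤ 2 q`.
  m*3≤2q = s≤s⁻¹ (ℕ.≤∧≢⇒< (m/n*n≤m k 3) λ m*3≡k → 3∤k (divides m (sym m*3≡k)))

  m≤q-1 : m ≤ 2 + h
  m≤q-1 = s≤s⁻¹ (ℕ.*-cancelʳ-< 3 m (3 + h) (ℕ.≤-<-trans m*3≤2q
    (subst (2 * (3 + h) <_) (ℕ.*-comm 3 (3 + h)) (ℕ.*-monoˡ-< (3 + h) (ℕ.n<1+n 2)))))

  bound : 2 ^ (3 * m ^ suc n) ≤ 2 ^ #cells D n * 2 ^ #cells D n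
  bound = begin
    2 ^ (3 * m ^ suc n)                  ≤⟨ ℕ.^-monoʳ-≤ 2 (#cells-bound D m≤q-1 (subst (_≤ 2 * (3 + h)) (ℕ.*-comm m 3) m*3≤2q) n) ⟩
    2 ^ (2 * #cells D n)                 ≡⟨ cong (λ c → 2 ^ (#cells D n + c)) (ℕ.+-identityʳ (#cells D n)) ⟩
    2 ^ (#cells D n + #cells D n)        ≡⟨ ℕ.^-distribˡ-+-* 2 (#cells D n) (#cells D n) ⟩
    2 ^ #cells D n * 2 ^ #cells D n      ∎

theorem3 : ((k n : ℕ) → 3 < k → 0 < n →
    ((2 ∣ k → AtLeast n k (2 ^ ((k / 2) ^ n)))
    × (3 ∣ k → AtLeast n k (2 ^ (n * (k / 3) ^ n)))
    × (¬ (2 ∣ k) → ¬ (3 ∣ k) → k ≢ 5 →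
    ∃ λ N → AtLeast n k N × 2 ^ (3 * (k / 3) ^ n) ≤ N * N)))
    × (Σ (Fin 3 → ℕ × ℕ) λ c →
    ((r : Fin 3) → 0 < proj₂ (c r) × 1000 * proj₁ (c r) < 72 * proj₂ (c r))
    × ((n : ℕ) → 0 < n →
    AtLeast2^3^ n (proj₁ (c (n mod 3))) (proj₂ (c (n mod 3)))))
-- The constant is 10/139 for all residues, and `1000 * 10 = 10000 < 10008 = 72 * 139`.
theorem3 = general , c , (λ _ → z<s , ℕ.≤ᵇ⇒≤ 10001 10008 tt) ,
  λ n → atLeast2^3^₅ n (proj₁ (c (n mod 3))) (proj₂ (c (n mod 3))) refl refl
  where
  c : Fin 3 → ℕ × ℕ
  c _ = 10 , 139

  general : (k n : ℕ) → 3 < k → 0 < n →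
    ((2 ∣ k → AtLeast n k (2 ^ ((k / 2) ^ n)))
    × (3 ∣ k → AtLeast n k (2 ^ (n * (k / 3) ^ n)))
    × (¬ (2 ∣ k) → ¬ (3 ∣ k) → k ≢ 5 →
    ∃ λ N → AtLeast n k N × 2 ^ (3 * (k / 3) ^ n) ≤ N * N))
  general k (suc n) 3<k _ = even , triple , atLeast-odd k n 3<k
    where
    even : 2 ∣ k → AtLeast (suc n) k (2 ^ ((k / 2) ^ suc n))
    even (divides zero    refl) = contradiction 3<k λ ()
    even (divides (suc q) refl) = subst (λ h → AtLeast (suc n) (suc q * 2) (2 ^ (h ^ suc n)))
      (sym (m*n/n≡m (suc q) 2)) (atLeast-even q (suc n))

    triple : 3 ∣ k → AtLeast (suc n) k (2 ^ (suc n * (k / 3) ^ suc n))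
    triple (divides zero    refl) = contradiction 3<k λ ()
    triple (divides (suc q) refl) = subst (λ h → AtLeast (suc n) (suc q * 3) (2 ^ (suc n * h ^ suc n)))
      (sym (m*n/n≡m (suc q) 3)) (atLeast-triple q (suc n))
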